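{- Let $n\geq 2$ and $k>2$ be integers. Then: (i) for an integer $r$ with $0\leq r\leq (k-1)n$, the digraph $S_k^{r,r}(n-1)$ is Eulerian if and only if $r\in\{0,1,(k-1)n-1,(k-1)n\}$; (ii) $S_k^{r,r+1}(n-1)$ is Eulerian for every integer $r$ with $0\leq r<(k-1)n$.
   Context: A $k$-ary $n$-tuple is an element of $\mathbb{Z}_k^n$, with entries identified with the integers $0,1,\dots,k-1$. The de Bruijn digraph $B_k(n-1)$ has vertex set $\mathbb{Z}_k^{n-1}$, and its edges are identified with the $k$-ary $n$-tuples: the $n$-tuple $(x_0,\dots,x_{n-1})$ is the edge from vertex $(x_0,\dots,x_{n-2})$ to vertex $(x_1,\dots,x_{n-1})$ (loops allowed). A subgraph "consisting of" a set of edges has exactly those edges, and its vertices are the vertices incident with at least one of them. A digraph is Eulerian if it is strongly connected (there is a directed path between any ordered pair of its vertices) and balanced (every vertex has in-degree equal to out-degree). The digit sum of a $k$-ary $n$-tuple $\mathbf{a}=(a_0,\dots,a_{n-1})$ is $w_s(\mathbf{a})=\sum_{i=0}^{n-1}a_i$, computed in $\mathbb{Z}$ with each $a_i$ an integer in $[0,k-1]$. For integers $0\leq r\leq s\leq n(k-1)$, $S_k^{r,s}(n-1)$ is the subgraph of $B_k(n-1)$ consisting of the edges corresponding to $n$-tuples $\mathbf{a}$ with $r\leq w_s(\mathbf{a})\leq s$. -}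

module Defs where

open import Data.Fin using (Fin; toℕ)
import Data.Fin.Properties as Fin
open import Data.List using (List; []; _∷_; allFin; cartesianProductWith; filter; length)
open import Data.List.Membership.Propositional using (_∈_)
open import Data.List.Membership.Propositional.Properties using (∈-allFin; ∈-cartesianProductWith⁺)
open import Data.List.Relation.Unary.All using ([])
open import Data.List.Relation.Unary.AllPairs using ([]; _∷_)
open import Data.List.Relation.Unary.Any using (here)
open import Data.List.Relation.Unary.Unique.Propositional using (Unique)
open import Data.List.Relation.Unary.Unique.Propositional.Properties using (allFin⁺; cartesianProductWith⁺)
open import Data.Nat using (ℕ; zero; suc; _≤_; _≤?_)
open import Data.Product using (_×_; ∃-syntax)
open import Data.Sum using (_⊎_)
open import Data.Vec using (Vec; []; _∷_; init; tail; map; sum)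
open import Data.Vec.Properties using (≡-dec; ∷-injective)
open import Level using (0ℓ)
open import Relation.Binary.Construct.Closure.ReflexiveTransitive using (Star)
open import Relation.Binary.Definitions using (DecidableEquality)
open import Relation.Binary.PropositionalEquality using (_≡_; refl)
open import Relation.Nullary.Decidable using (_×-dec_)
open import Relation.Unary using (Pred; Decidable)

Tuple : ℕ → ℕ → Set
Tuple k n = Vec (Fin k) n

_≟_ : ∀ {k n} → DecidableEquality (Tuple k n)
_≟_ = ≡-dec Fin._≟_

allTuples : ∀ k n → List (Tuple k n)
allTuples k zero    = [] ∷ []
allTuples k (suc n) = cartesianProductWith _∷_ (allFin k) (allTuples k n)

-- Every tuple is listed exactly once, so lengths of filtered sublists of
-- allTuples are genuine cardinalities.

∈-allTuples : ∀ {k n} (a : Tuple k n) → a ∈ allTuples k n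
∈-allTuples []      = here refl
∈-allTuples (x ∷ a) = ∈-cartesianProductWith⁺ _∷_ (∈-allFin x) (∈-allTuples a)

allTuples-unique : ∀ k n → Unique (allTuples k n)
allTuples-unique k zero    = [] ∷ []
allTuples-unique k (suc n) =
  cartesianProductWith⁺ _∷_ ∷-injective (allFin⁺ k) (allTuples-unique k n)

-- The de Bruijn digraph B_k(m): vertices are k-ary m-tuples, and the
-- (m + 1)-tuple a is an edge from source a to target a.

source target : ∀ {k m} → Tuple k (suc m) → Tuple k m
source = init
target = tail

-- A subgraph of B_k(m) consisting of a (decidable) set of edges.
record Subgraph (k m : ℕ) : Set₁ where
  field
    Edge  : Pred (Tuple k (suc m)) 0ℓ
    Edge? : Decidable Edge

  -- Only the vertices incident with an edge of the subgraph belong to it.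
  IsVertex : Pred (Tuple k m) 0ℓ
  IsVertex v = ∃[ a ] Edge a × (source a ≡ v ⊎ target a ≡ v)

  _⟶_ : Tuple k m → Tuple k m → Set
  u ⟶ v = ∃[ a ] Edge a × source a ≡ u × target a ≡ v

  inDegree outDegree : Tuple k m → ℕ
  inDegree  v = length (filter (λ a → Edge? a ×-dec (target a ≟ v)) (allTuples k (suc m)))
  outDegree v = length (filter (λ a → Edge? a ×-dec (source a ≟ v)) (allTuples k (suc m)))

  StronglyConnected : Set
  StronglyConnected = ∀ u v → IsVertex u → IsVertex v → Star _⟶_ u v

  Balanced : Set
  Balanced = ∀ v → IsVertex v → inDegree v ≡ outDegree v

  Eulerian : Set
  Eulerian = StronglyConnected × Balanced

open Subgraph public using (Eulerian)

digitSum : ∀ {k n} → Tuple k n → ℕ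
digitSum a = sum (map toℕ a)

-- S k r s m is S_k^{r,s}(m); its edges are (m + 1)-tuples.
S : (k r s m : ℕ) → Subgraph k m
S k r s m = record
  { Edge  = λ a → r ≤ digitSum a × digitSum a ≤ s
  ; Edge? = λ a → (r ≤? digitSum a) ×-dec (digitSum a ≤? s)
  }

{-# OPTIONS --safe #-}

-- A tuple of digit sum r can be followed inside S_k^{r,r} only by its rotation, so
-- S_k^{r,r} is a disjoint union of cycles, one for each necklace of sum r. There is a
-- single such necklace when r = 0 or r = 1, hence by complementing digits also when r is
-- the maximal sum or one less; for any other r, moving a unit between two digits yields a
-- second necklace. In S_k^{r,r+1} one may in addition alter the last digit after a
-- rotation, so after further rotations any digit can be raised (from sum r) or lowered
-- (from sum r + 1); these changes reach every tuple by descent on the L¹ distance.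
-- Rotation matches incoming with outgoing edges at a vertex, which gives balance.

module Submission where

open import Defs
open import Data.Fin as Fin using (Fin; toℕ; fromℕ<; opposite)
import Data.Fin.Properties as Fin
open import Data.List as List using (List; []; _∷_; _++_; [_]; length; filter)
open import Data.List.Membership.Propositional using (_∈_)
open import Data.List.Membership.Propositional.Properties
  using (∈-filter⁺; ∈-filter⁻; ∈-map∘filter⁺; ∈-map∘filter⁻)
open import Data.List.Membership.Propositional.Properties.WithK using (unique∧set⇒bag)
import Data.List.Properties as List
open import Data.List.Relation.Binary.BagAndSetEquality using (∼bag⇒↭)
open import Data.List.Relation.Binary.Permutation.Propositional
  using (_↭_; ↭-refl; ↭-trans)
open import Data.List.Relation.Binary.Permutation.Propositional.Properties
  using (↭-length; ∈-resp-↭; drop-∷; ∷↭∷ʳ; ++-comm; map⁺)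
open import Data.List.Relation.Unary.Any using (here; there)
import Data.List.Relation.Unary.Unique.Propositional.Properties as Unique
open import Data.Nat hiding (_≟_)
open import Data.Nat.ListAction using (sum)
open import Data.Nat.ListAction.Properties using (sum-++; sum-↭)
open import Data.Nat.Properties hiding (_≟_)
open import Data.Nat.Solver using (module +-*-Solver)
open import Data.Product using (_×_; _,_; ∃; ∃₂; ∃-syntax; proj₁; proj₂)
open import Data.Sum using (_⊎_; inj₁; inj₂)
open import Data.Vec as Vec using ([]; _∷_; _∷ʳ_; toList; initLast; lookup; _[_]≔_)
import Data.Vec.Properties as Vec
open import Function using (_∘_)
open import Function.Bundles using (_⇔_; mk⇔)
open import Relation.Binary.Construct.Closure.ReflexiveTransitive as Star using (Star; ε; _◅_; _◅◅_)
open import Relation.Binary.PropositionalEquality hiding ([_])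
open import Relation.Nullary using (¬_; yes; no; contradiction)
open import Relation.Nullary.Decidable using (_×-dec_)
open import Relation.Unary using (Decidable)

private variable
  k m n r s : ℕ

-- Digit sums and rotation.

weight : List (Fin k) → ℕ
weight l = sum (List.map toℕ l)

weight-↭ : {l l′ : List (Fin k)} → l ↭ l′ → weight l ≡ weight l′
weight-↭ = sum-↭ ∘ map⁺ toℕ

digitSum≡weight : (a : Tuple k n) → digitSum a ≡ weight (toList a)
digitSum≡weight []      = refl
digitSum≡weight (x ∷ a) = cong (toℕ x +_) (digitSum≡weight a)

toList-injective : (a b : Tuple k n) → toList a ≡ toList b → a ≡ b
toList-injective a b eq =
  trans (sym (Vec.cast-is-id refl a)) (Vec.toList-injective refl a b eq)

rotate : Tuple k (suc m) → Tuple k (suc m)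
rotate (x ∷ v) = v ∷ʳ x

toList-rotate : (a : Tuple k (suc m)) → toList a ↭ toList (rotate a)
toList-rotate (x ∷ v) = subst (x ∷ toList v ↭_) (sym (Vec.toList-∷ʳ x v)) (∷↭∷ʳ x (toList v))

rotate-injective : {a b : Tuple k (suc m)} → rotate a ≡ rotate b → a ≡ b
rotate-injective {a = x ∷ v} {y ∷ w} eq with refl , refl ← Vec.∷ʳ-injective v w eq = refl

digitSum-rotate : (a : Tuple k (suc m)) → digitSum (rotate a) ≡ digitSum a
digitSum-rotate a = begin
  digitSum (rotate a)         ≡⟨ digitSum≡weight (rotate a) ⟩
  weight (toList (rotate a))  ≡⟨ weight-↭ (toList-rotate a) ⟨
  weight (toList a)           ≡⟨ digitSum≡weight a ⟨
  digitSum a                  ∎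
  where open ≡-Reasoning

source-rotate : (a : Tuple k (suc m)) → source (rotate a) ≡ target a
source-rotate (x ∷ v) = Vec.init-∷ʳ x v

-- Walks as sequences of shifts of words.

module _ {k : ℕ} (r s : ℕ) where

  InRange : List (Fin k) → Set
  InRange l = r ≤ weight l × weight l ≤ s

  inRange-↭ : ∀ {l l′} → l ↭ l′ → InRange l → InRange l′
  inRange-↭ p = subst (λ w → r ≤ w × w ≤ s) (weight-↭ p)

  -- Edges are kept as lists here, so that u ++ w and w ++ u have the same type.
  data Shift : List (Fin k) → List (Fin k) → Set where
    shift : ∀ x v y → InRange (x ∷ v) → Shift (x ∷ v) (v ++ [ y ])

  rotations : ∀ u w → InRange (u ++ w) → Star Shift (u ++ w) (w ++ u)
  rotations []      w ok = subst (Star Shift w) (sym (List.++-identityʳ w)) ε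
  rotations (x ∷ u) w ok =
    shift x (u ++ w) x ok ◅
    subst₂ (Star Shift) (sym (List.++-assoc u w [ x ])) (List.++-assoc w [ x ] u)
      (rotations u (w ++ [ x ])
        (subst InRange (List.++-assoc u w [ x ]) (inRange-↭ (∷↭∷ʳ x (u ++ w)) ok)))

  -- Rotating by `u` brings `x` to the front, one shift drops it and appends `y`, and rotating by
  -- `w` puts `y` where `x` was. Every word on the way is a rotation of one of the two ends, so
  -- range conditions on the ends suffice.
  replaceDigit : ∀ u w x y → InRange (u ++ x ∷ w) → InRange (u ++ y ∷ w) →
    Star Shift (u ++ x ∷ w) (u ++ y ∷ w)
  replaceDigit u w x y okx oky =
    rotations u (x ∷ w) okx ◅◅
    (shift x (w ++ u) y (inRange-↭ (++-comm u (x ∷ w)) okx) ◅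
     subst₂ (Star Shift) (sym (List.++-assoc w u [ y ])) (List.++-assoc u [ y ] w)
       (rotations w (u ++ [ y ]) (inRange-↭ cyc oky)))
    where
    cyc : u ++ y ∷ w ↭ w ++ u ++ [ y ]
    cyc = subst (_↭ w ++ u ++ [ y ]) (List.++-assoc u [ y ] w) (++-comm (u ++ [ y ]) w)

-- Balance, and strong connectivity in terms of edges.

module _ (k r s m : ℕ) where
  open Subgraph (S k r s m) hiding (Eulerian)

  rotate-edge : ∀ a → Edge a → Edge (rotate a)
  rotate-edge a = subst (λ w → r ≤ w × w ≤ s) (sym (digitSum-rotate a))

  rotate-edge⁻ : ∀ a → Edge (rotate a) → Edge a
  rotate-edge⁻ a = subst (λ w → r ≤ w × w ≤ s) (digitSum-rotate a)

  -- Rotation is injective, keeps the digit sum and turns an edge into `v` into an edge out of `v`;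
  -- every edge out of `v` arises so, by moving its last digit to the front. The rotated in-edges
  -- and the out-edges are thus duplicate-free lists with the same members.
  balanced : Balanced
  balanced v _ = begin
    length ins                     ≡⟨ List.length-map rotate ins ⟨
    length (List.map rotate ins)   ≡⟨ ↭-length (∼bag⇒↭ (unique∧set⇒bag
                                        (Unique.map⁺ rotate-injective (Unique.filter⁺ in? unique))
                                        (Unique.filter⁺ out? unique)
                                        (mk⇔ to from))) ⟩
    length outs                    ∎
    where
    open ≡-Reasoning
    unique = allTuples-unique k (suc m)
    in? : Decidable (λ a → Edge a × target a ≡ v)
    in? a = Edge? a ×-dec (target a ≟ v)
    out? : Decidable (λ a → Edge a × source a ≡ v)
    out? a = Edge? a ×-dec (source a ≟ v)
    ins  = filter in? (allTuples k (suc m))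
    outs = filter out? (allTuples k (suc m))

    to : ∀ {a} → a ∈ List.map rotate ins → a ∈ outs
    to a∈ with b , _ , refl , e , t ← ∈-map∘filter⁻ rotate in? {xs = allTuples k (suc m)} a∈ =
      ∈-filter⁺ out? (∈-allTuples _) (rotate-edge b e , trans (source-rotate b) t)

    from : ∀ {a} → a ∈ outs → a ∈ List.map rotate ins
    from {a} a∈ with initLast a | ∈-filter⁻ out? {xs = allTuples k (suc m)} a∈
    ... | w , x , refl | _ , e , t =
      ∈-map∘filter⁺ rotate in? (x ∷ w , ∈-allTuples _ , refl , rotate-edge⁻ (x ∷ w) e , t)

  EdgesConnected : Set
  EdgesConnected = ∀ a b → Edge a → Edge b → Star _⟶_ (source a) (source b)

  -- Every vertex is the source of an edge: the target of `a` is the source of `rotate a`.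
  edgesConnected⇒eulerian : EdgesConnected → Eulerian (S k r s m)
  edgesConnected⇒eulerian con = strong , balanced
    where
    leaving : ∀ {v} → IsVertex v → ∃[ a ] Edge a × source a ≡ v
    leaving (a , e , inj₁ eq) = a , e , eq
    leaving (a , e , inj₂ eq) = rotate a , rotate-edge a e , trans (source-rotate a) eq

    strong : StronglyConnected
    strong u v pu pv with leaving pu | leaving pv
    ... | a , ea , refl | b , eb , refl = con a b ea eb

  edge⇒inRange : ∀ a → Edge a → InRange r s (toList a)
  edge⇒inRange a = subst (λ w → r ≤ w × w ≤ s) (digitSum≡weight a)

  -- Each shift traverses the edge given by the word before it, whose target is the source of the
  -- word after it. The final word is not traversed, so the walk stops at `source b`.
  shifts⇒walk : ∀ {l l′} → Star (Shift r s) l l′ → (a b : Tuple k (suc m)) →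
    toList a ≡ l → toList b ≡ l′ → Star _⟶_ (source a) (source b)
  shifts⇒walk ε a b eq eq′ with refl ← toList-injective a b (trans eq (sym eq′)) = ε
  shifts⇒walk (shift x v y ok ◅ p) (x ∷ v′) b refl eq′ =
    (x ∷ v′ , subst (λ w → r ≤ w × w ≤ s) (sym (digitSum≡weight (x ∷ v′))) ok , refl
            , sym (Vec.init-∷ʳ y v′))
    ◅ shifts⇒walk p (v′ ∷ʳ y) b (Vec.toList-∷ʳ y v′) eq′

-- Changing one digit: effect on digit sum and distance.

splitAtDigit : (a : Tuple k n) (i : Fin n) → ∃₂ λ u w → ∀ x → toList (a [ i ]≔ x) ≡ u ++ x ∷ w
splitAtDigit (x ∷ a) Fin.zero    = [] , toList a , λ _ → refl
splitAtDigit (x ∷ a) (Fin.suc i) with u , w , eq ← splitAtDigit a i =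
  x ∷ u , w , λ y → cong (x ∷_) (eq y)

digitSum-≔ : (a : Tuple k n) (i : Fin n) (x : Fin k) →
  digitSum (a [ i ]≔ x) + toℕ (lookup a i) ≡ digitSum a + toℕ x
digitSum-≔ (y ∷ a) Fin.zero    x = solve 3 (λ x y s → (x :+ s) :+ y := (y :+ s) :+ x) refl
                                     (toℕ x) (toℕ y) (digitSum a)
  where open +-*-Solver
digitSum-≔ (y ∷ a) (Fin.suc i) x = begin
  toℕ y + digitSum (a [ i ]≔ x) + toℕ (lookup a i)    ≡⟨ +-assoc (toℕ y) _ _ ⟩
  toℕ y + (digitSum (a [ i ]≔ x) + toℕ (lookup a i))  ≡⟨ cong (toℕ y +_) (digitSum-≔ a i x) ⟩
  toℕ y + (digitSum a + toℕ x)                        ≡⟨ +-assoc (toℕ y) _ _ ⟨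
  toℕ y + digitSum a + toℕ x                          ∎
  where open ≡-Reasoning

distance : Tuple k n → Tuple k n → ℕ
distance []      []      = 0
distance (x ∷ a) (y ∷ b) = ∣ toℕ x - toℕ y ∣ + distance a b

distance-≔ : (a b : Tuple k n) (i : Fin n) (x : Fin k) →
  suc ∣ toℕ x - toℕ (lookup b i) ∣ ≡ ∣ toℕ (lookup a i) - toℕ (lookup b i) ∣ →
  suc (distance (a [ i ]≔ x) b) ≡ distance a b
distance-≔ (_ ∷ a) (_ ∷ b) Fin.zero    x eq = cong (_+ distance a b) eq
distance-≔ (y ∷ a) (z ∷ b) (Fin.suc i) x eq =
  trans (sym (+-suc _ _)) (cong (∣ toℕ y - toℕ z ∣ +_) (distance-≔ a b i x eq))

∣suc-∣ˡ : ∀ {p q} → p < q → suc ∣ suc p - q ∣ ≡ ∣ p - q ∣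
∣suc-∣ˡ {zero}  {suc q} _         = refl
∣suc-∣ˡ {suc p} {suc q} (s≤s p<q) = ∣suc-∣ˡ p<q

∣suc-∣ʳ : ∀ {p q} → q ≤ p → suc ∣ p - q ∣ ≡ ∣ suc p - q ∣
∣suc-∣ʳ {p}     {zero}  _         = cong suc (∣-∣-identityʳ p)
∣suc-∣ʳ {suc p} {suc q} (s≤s q≤p) = ∣suc-∣ʳ q≤p

-- If no digit of `a` is below that of `b`, then `a` dominates `b` digitwise, and the bound on the
-- sums leaves only equality.
smallerDigit : (a b : Tuple k n) → digitSum a ≤ digitSum b →
  a ≡ b ⊎ ∃[ i ] lookup a i Fin.< lookup b i
smallerDigit []      []      _  = inj₁ refl
smallerDigit (x ∷ a) (y ∷ b) le with toℕ x <? toℕ y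
... | yes x<y = inj₂ (Fin.zero , x<y)
... | no  x≮y with smallerDigit a b (+-cancelˡ-≤ (toℕ y) _ _
                     (≤-trans (+-monoˡ-≤ (digitSum a) (≮⇒≥ x≮y)) le))
...   | inj₂ (i , lt) = inj₂ (Fin.suc i , lt)
...   | inj₁ refl with refl ← Fin.toℕ-injective (≤-antisym (+-cancelʳ-≤ (digitSum a) _ _ le) (≮⇒≥ x≮y))
        = inj₁ refl

digitSum-raise : (a : Tuple k n) (i : Fin n) (x : Fin k) → toℕ x ≡ suc (toℕ (lookup a i)) →
  digitSum (a [ i ]≔ x) ≡ suc (digitSum a)
digitSum-raise a i x eq = +-cancelʳ-≡ (toℕ (lookup a i)) _ _ (begin
  digitSum (a [ i ]≔ x) + toℕ (lookup a i)  ≡⟨ digitSum-≔ a i x ⟩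
  digitSum a + toℕ x                        ≡⟨ cong (digitSum a +_) eq ⟩
  digitSum a + suc (toℕ (lookup a i))       ≡⟨ +-suc _ _ ⟩
  suc (digitSum a) + toℕ (lookup a i)       ∎)
  where open ≡-Reasoning

digitSum-lower : (a : Tuple k n) (i : Fin n) (x : Fin k) → suc (toℕ x) ≡ toℕ (lookup a i) →
  suc (digitSum (a [ i ]≔ x)) ≡ digitSum a
digitSum-lower a i x eq = +-cancelʳ-≡ (toℕ x) _ _ (begin
  suc (digitSum (a [ i ]≔ x)) + toℕ x       ≡⟨ +-suc _ _ ⟨
  digitSum (a [ i ]≔ x) + suc (toℕ x)       ≡⟨ cong (digitSum (a [ i ]≔ x) +_) eq ⟩
  digitSum (a [ i ]≔ x) + toℕ (lookup a i)  ≡⟨ digitSum-≔ a i x ⟩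
  digitSum a + toℕ x                        ∎)
  where open ≡-Reasoning

nextDigit : (x y : Fin k) → x Fin.< y → ∃ λ (z : Fin k) → toℕ z ≡ suc (toℕ x)
nextDigit x y x<y = fromℕ< x+1<k , Fin.toℕ-fromℕ< x+1<k
  where x+1<k = ≤-<-trans x<y (Fin.toℕ<n y)

previousDigit : (x y : Fin k) → y Fin.< x → ∃ λ (z : Fin k) → suc (toℕ z) ≡ toℕ x
previousDigit (Fin.suc x) _ _ = Fin.inject₁ x , cong suc (Fin.toℕ-inject₁ x)

-- Two consecutive digit sums.

module _ (k r m : ℕ) where
  open Subgraph (S k r (suc r) m) hiding (Eulerian)

  private
    Shifts : Tuple k (suc m) → Tuple k (suc m) → Set
    Shifts a b = Star (Shift r (suc r)) (toList a) (toList b)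

  replaceOne : ∀ a i x → Edge a → Edge (a [ i ]≔ x) → Shifts a (a [ i ]≔ x)
  replaceOne a i x e e′ with u , w , eq ← splitAtDigit a i =
    subst₂ (Star (Shift r (suc r))) (sym split) (sym (eq x))
      (replaceDigit r (suc r) u w (lookup a i) x
        (subst (InRange r (suc r)) split (edge⇒inRange k r (suc r) m a e))
        (subst (InRange r (suc r)) (eq x) (edge⇒inRange k r (suc r) m (a [ i ]≔ x) e′)))
    where
    split : toList a ≡ u ++ lookup a i ∷ w
    split = trans (cong toList (sym (Vec.[]≔-lookup a i))) (eq (lookup a i))

  -- A tuple of sum r may raise a digit and one of sum r + 1 may lower a digit; as long
  -- as the goal is not reached, one such change brings the tuple closer to it.
  approach : ∀ d a b → distance a b ≡ d → Edge a → Edge b → Shifts a b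
  moveTo : ∀ d a b i x → distance a b ≡ d → Edge a → Edge b → Edge (a [ i ]≔ x) →
    suc ∣ toℕ x - toℕ (lookup b i) ∣ ≡ ∣ toℕ (lookup a i) - toℕ (lookup b i) ∣ → Shifts a b

  -- The distance is a successor, hence so is `d`, and the recursion is structural in `d`.
  moveTo d a b i x dist ea eb ea′ closer with d | trans (distance-≔ a b i x closer) dist
  ... | suc d′ | eq =
    replaceOne a i x ea ea′ ◅◅ approach d′ (a [ i ]≔ x) b (suc-injective eq) ea′ eb

  approach d a b dist ea@(r≤a , hi) eb with m≤n⇒m<n∨m≡n hi
  -- At the lower level the sum of `a` is at most that of `b`, at the upper level at least;
  -- `smallerDigit` applies in one order or the other.
  ... | inj₁ (s≤s a≤r) with smallerDigit a b (≤-trans a≤r (proj₁ eb))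
  ...   | inj₁ refl = ε
  ...   | inj₂ (i , lt) with x , eq ← nextDigit (lookup a i) (lookup b i) lt =
    moveTo d a b i x dist ea eb
      (subst (λ w → r ≤ w × w ≤ suc r) (sym (digitSum-raise a i x eq)) (m≤n⇒m≤1+n r≤a , s≤s a≤r))
      (trans (cong (λ p → suc ∣ p - toℕ (lookup b i) ∣) eq) (∣suc-∣ˡ lt))
  approach d a b dist ea@(_ , hi) eb | inj₂ a≡1+r
    with smallerDigit b a (≤-trans (proj₂ eb) (≤-reflexive (sym a≡1+r)))
  ...   | inj₁ refl = ε
  ...   | inj₂ (i , lt) with x , eq ← previousDigit (lookup a i) (lookup b i) lt =
    moveTo d a b i x dist ea eb (≤-reflexive (sym a′≡r) , ≤-trans (≤-reflexive a′≡r) (n≤1+n r))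
      (trans (∣suc-∣ʳ {toℕ x} (s≤s⁻¹ (≤-trans lt (≤-reflexive (sym eq)))))
             (cong (λ p → ∣ p - toℕ (lookup b i) ∣) eq))
    where
    a′≡r : digitSum (a [ i ]≔ x) ≡ r
    a′≡r = suc-injective (trans (digitSum-lower a i x eq) a≡1+r)

  twoLevels-eulerian : Eulerian (S k r (suc r) m)
  twoLevels-eulerian = edgesConnected⇒eulerian k r (suc r) m λ a b ea eb →
    shifts⇒walk k r (suc r) m (approach (distance a b) a b refl ea eb) a b refl refl

-- Digit sums 0 and 1.

weightZero-unique : (l l′ : List (Fin k)) → length l ≡ length l′ →
  weight l ≡ 0 → weight l′ ≡ 0 → l ≡ l′
weightZero-unique []      []       _   _  _   = refl
weightZero-unique (x ∷ l) (y ∷ l′) len w0 w0′ =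
  cong₂ _∷_
    (Fin.toℕ-injective (trans (m+n≡0⇒m≡0 (toℕ x) w0) (sym (m+n≡0⇒m≡0 (toℕ y) w0′))))
    (weightZero-unique l l′ (suc-injective len) (m+n≡0⇒n≡0 (toℕ x) w0) (m+n≡0⇒n≡0 (toℕ y) w0′))

weight-++ : (u w : List (Fin k)) → weight (u ++ w) ≡ weight u + weight w
weight-++ u w = trans (cong sum (List.map-++ toℕ u w)) (sum-++ (List.map toℕ u) (List.map toℕ w))

-- The zeros are collected as `w ++ u` because this is what follows the digit 1 once it has been
-- rotated to the front.
weightOne-split : (l : List (Fin (2 + k))) → weight l ≡ 1 →
  ∃₂ λ u w → l ≡ u ++ Fin.suc Fin.zero ∷ w × weight (w ++ u) ≡ 0
weightOne-split (Fin.zero ∷ l) w1 with u , w , eq , w0 ← weightOne-split l w1 =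
  Fin.zero ∷ u , w , cong (Fin.zero ∷_) eq ,
  trans (weight-++ w (Fin.zero ∷ u)) (trans (sym (weight-++ w u)) w0)
weightOne-split (Fin.suc Fin.zero ∷ l) w1 =
  [] , l , refl , trans (cong weight (List.++-identityʳ l)) (suc-injective w1)
weightOne-split (Fin.suc (Fin.suc x) ∷ l) ()

module _ (k m : ℕ) where

  level₀-connected : EdgesConnected k 0 0 m
  level₀-connected a b (_ , a≤0) (_ , b≤0)
    with refl ← toList-injective a b (weightZero-unique (toList a) (toList b)
           (trans (Vec.length-toList a) (sym (Vec.length-toList b)))
           (trans (sym (digitSum≡weight a)) (n≤0⇒n≡0 a≤0))
           (trans (sym (digitSum≡weight b)) (n≤0⇒n≡0 b≤0))) = ε

  -- With the digit 1 rotated to the front, both tuples become 1 followed by `m` zeros; the walk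
  -- goes through this common rotation.
  level₁-connected : EdgesConnected (2 + k) 1 1 m
  level₁-connected a b ea eb
    with ra ← edge⇒inRange (2 + k) 1 1 m a ea | rb ← edge⇒inRange (2 + k) 1 1 m b eb
    with u , w , eqa , wu0 ← weightOne-split (toList a) (≤-antisym (proj₂ ra) (proj₁ ra))
       | u′ , w′ , eqb , wu0′ ← weightOne-split (toList b) (≤-antisym (proj₂ rb) (proj₁ rb))
    = shifts⇒walk (2 + k) 1 1 m
        (rotations 1 1 u (one ∷ w) (subst (InRange 1 1) eqa ra) ◅◅
         subst (λ z → Star (Shift 1 1) (one ∷ z) (u′ ++ one ∷ w′)) (sym wu≡wu′)
           (rotations 1 1 (one ∷ w′) u′
             (inRange-↭ 1 1 (++-comm u′ (one ∷ w′))
               (subst (InRange 1 1) eqb rb))))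
        a b eqa eqb
    where
    one : Fin (2 + k)
    one = Fin.suc Fin.zero

    rest-length : (c : Tuple (2 + k) (suc m)) (u w : List (Fin (2 + k))) →
      toList c ≡ u ++ one ∷ w → suc (length (w ++ u)) ≡ suc m
    rest-length c u w eq = begin
      length (one ∷ w ++ u)  ≡⟨ ↭-length (++-comm (one ∷ w) u) ⟩
      length (u ++ one ∷ w)  ≡⟨ cong length eq ⟨
      length (toList c)      ≡⟨ Vec.length-toList c ⟩
      suc m                  ∎
      where open ≡-Reasoning

    wu≡wu′ : w ++ u ≡ w′ ++ u′
    wu≡wu′ = weightZero-unique (w ++ u) (w′ ++ u′)
      (suc-injective (trans (rest-length a u w eqa) (sym (rest-length b u′ w′ eqb)))) wu0 wu0′

-- Complementing digits.

complement : Tuple k n → Tuple k n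
complement = Vec.map opposite

complement-involutive : (a : Tuple k n) → complement (complement a) ≡ a
complement-involutive []      = refl
complement-involutive (x ∷ a) = cong₂ _∷_ (Fin.opposite-involutive x) (complement-involutive a)

source-complement : (a : Tuple k (suc m)) → source (complement a) ≡ complement (source a)
source-complement (x ∷ [])    = refl
source-complement (x ∷ y ∷ a) = cong (opposite x ∷_) (source-complement (y ∷ a))

target-complement : (a : Tuple k (suc m)) → target (complement a) ≡ complement (target a)
target-complement (x ∷ a) = refl

digitSum-complement : (a : Tuple (suc k) n) → digitSum (complement a) + digitSum a ≡ n * k
digitSum-complement []      = refl
digitSum-complement {k} {suc n} (x ∷ a) = begin
  (toℕ (opposite x) + digitSum (complement a)) + (toℕ x + digitSum a)
    ≡⟨ interchange (toℕ (opposite x)) _ (toℕ x) _ ⟩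
  (toℕ (opposite x) + toℕ x) + (digitSum (complement a) + digitSum a)
    ≡⟨ cong₂ _+_ (trans (cong (_+ toℕ x) (Fin.opposite-prop x)) (m∸n+n≡m (Fin.toℕ≤pred[n] x)))
                 (digitSum-complement a) ⟩
  k + n * k ∎
  where
  open ≡-Reasoning
  open import Algebra.Properties.CommutativeSemigroup +-commutativeSemigroup using (interchange)

-- Complementation commutes with `source` and `target` and exchanges the sums `r` and `s`, so it
-- carries walks of one level to the other; being an involution, it also restores the endpoints.
complement-connected : r + s ≡ suc m * k → EdgesConnected (suc k) r r m → EdgesConnected (suc k) s s m
complement-connected {r} {s} {m} {k} r+s≡mk con a b ea eb =
  subst₂ (Star (_⟶_ (S (suc k) s s m))) (back a) (back b)
    (Star.gmap complement (λ {u} {v} → flip-step {u} {v})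
      (con (complement a) (complement b) (flip-edge s r (trans (+-comm s r) r+s≡mk) a ea)
           (flip-edge s r (trans (+-comm s r) r+s≡mk) b eb)))
  where
  open Subgraph using (Edge; _⟶_)

  flip-edge : ∀ p q → p + q ≡ suc m * k → ∀ c →
    Edge (S (suc k) p p m) c → Edge (S (suc k) q q m) (complement c)
  flip-edge p q p+q≡mk c (p≤c , c≤p) = ≤-reflexive (sym c̄≡q) , ≤-reflexive c̄≡q
    where
    c̄≡q : digitSum (complement c) ≡ q
    c̄≡q = +-cancelʳ-≡ p _ _ (begin
      digitSum (complement c) + p           ≡⟨ cong (digitSum (complement c) +_) (≤-antisym p≤c c≤p) ⟩
      digitSum (complement c) + digitSum c  ≡⟨ digitSum-complement c ⟩
      suc m * k                             ≡⟨ p+q≡mk ⟨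
      p + q                                 ≡⟨ +-comm p q ⟩
      q + p                                 ∎)
      where open ≡-Reasoning

  flip-step : ∀ {u v} → _⟶_ (S (suc k) r r m) u v →
    _⟶_ (S (suc k) s s m) (complement u) (complement v)
  flip-step (c , e , refl , refl) =
    complement c , flip-edge r s r+s≡mk c e , source-complement c , target-complement c

  back : ∀ (c : Tuple (suc k) (suc m)) → complement (source (complement c)) ≡ source c
  back c = trans (sym (source-complement (complement c))) (cong source (complement-involutive c))

-- Walks with constant digit sum.

source-injective : (a b : Tuple k (suc m)) → digitSum a ≡ digitSum b → source a ≡ source b → a ≡ b
source-injective a b eq src with initLast a | initLast b
... | v , x , refl | w , y , refl with refl ← src
  -- The last digit is what the sum leaves over; rotating it to the front lets `digitSum v` be
  -- cancelled.
  = cong (v ∷ʳ_) (Fin.toℕ-injective (+-cancelʳ-≡ (digitSum v) _ _ (begin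
      digitSum (x ∷ v)   ≡⟨ digitSum-rotate (x ∷ v) ⟨
      digitSum (v ∷ʳ x)  ≡⟨ eq ⟩
      digitSum (v ∷ʳ y)  ≡⟨ digitSum-rotate (y ∷ v) ⟩
      digitSum (y ∷ v)   ∎)))
  where open ≡-Reasoning

module _ (k r m : ℕ) where
  open Subgraph (S k r r m) hiding (Eulerian)

  sameSum : ∀ a b → Edge a → Edge b → digitSum a ≡ digitSum b
  sameSum _ _ (r≤a , a≤r) (r≤b , b≤r) = ≤-antisym (≤-trans a≤r r≤b) (≤-trans b≤r r≤a)

  -- By `source-injective` the only edge leaving `source a` is `a`, so the first step is forced and
  -- ends at the source of `rotate a`.
  walk⇒↭ : ∀ {u v} → Star _⟶_ u v → ∀ a b → Edge a → Edge b →
    source a ≡ u → source b ≡ v → toList a ↭ toList b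
  walk⇒↭ ε a b ea eb refl eq
    with refl ← source-injective a b (sameSum a b ea eb) (sym eq) = ↭-refl
  walk⇒↭ ((c , ec , refl , refl) ◅ p) a b ea eb eq eq′
    with refl ← source-injective a c (sameSum a c ea ec) eq =
    ↭-trans (toList-rotate a)
      (walk⇒↭ p (rotate a) b (rotate-edge k r r m a ea) eb (source-rotate a) eq′)

-- Two necklaces at every middle digit sum.

record Inequivalent (k n r : ℕ) : Set where
  constructor inequivalent
  field
    left right : Tuple k n
    leftSum    : digitSum left ≡ r
    rightSum   : digitSum right ≡ r
    not↭       : ¬ (toList left ↭ toList right)

-- Moving a unit from the larger to the smaller of two digits differing by at least 2.
levellingPair : ∀ x y → y < x → x < k → Inequivalent (suc k) 2 (suc x + y)
levellingPair {k} x y y<x x<k =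
  inequivalent (digit 1+x<1+k ∷ digit y<1+k ∷ []) (digit x<1+k ∷ digit 1+y<1+k ∷ [])
    (pairSum 1+x<1+k y<1+k)
    (trans (pairSum x<1+k 1+y<1+k) (+-suc x y))
    -- The digit `suc x` occurs on the left only: the right has `x` and `suc y`, and `y < x`.
    λ p → absurd (∈-resp-↭ p (here refl))
  where
  digit : ∀ {i} → i < suc k → Fin (suc k)
  digit i<k = fromℕ< i<k
  pairSum : ∀ {i j} (i<k : i < suc k) (j<k : j < suc k) →
    digitSum (digit i<k ∷ digit j<k ∷ []) ≡ i + j
  pairSum i<k j<k =
    cong₂ _+_ (Fin.toℕ-fromℕ< i<k) (trans (+-identityʳ _) (Fin.toℕ-fromℕ< j<k))
  1+x<1+k = s≤s x<k
  x<1+k   = m≤n⇒m≤1+n x<k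
  1+y<1+k = s≤s (<-trans y<x x<k)
  y<1+k   = m≤n⇒m≤1+n (<-trans y<x x<k)
  absurd : ¬ (digit 1+x<1+k ∈ digit x<1+k ∷ digit 1+y<1+k ∷ [])
  absurd (here eq)         = 1+n≢n (Fin.fromℕ<-injective _ _ 1+x<1+k x<1+k eq)
  absurd (there (here eq)) = <⇒≢ y<x (sym (suc-injective (Fin.fromℕ<-injective _ _ 1+x<1+k 1+y<1+k eq)))

-- Asking for different multisets of digits, not merely different necklaces, lets the common digit
-- be cancelled.
prepend : (c : Fin k) → Inequivalent k n r → Inequivalent k (suc n) (toℕ c + r)
prepend c (inequivalent a b a≡r b≡r a≁b) =
  inequivalent (c ∷ a) (c ∷ b) (cong (toℕ c +_) a≡r) (cong (toℕ c +_) b≡r) (a≁b ∘ drop-∷)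

-- Induction on the length down to a `levellingPair`. A sum up to the largest digit `k` is padded
-- with 0; a sum of at least `2 + k` gives up a digit `k`, and the remainder is again a middle sum.
middleLevel : ∀ n r → 2 ≤ k → 2 ≤ r → 2 + r ≤ (2 + n) * k → Inequivalent (suc k) (2 + n) r
middleLevel {suc k} n r 2≤k 2≤r hi with r ≤? suc k
middleLevel {suc k} zero (suc zero) _ (s≤s ()) _ | yes _
middleLevel {suc k} zero (suc (suc x)) _ (s≤s (s≤s z≤n)) _ | yes r≤k =
  subst (Inequivalent _ 2) (+-identityʳ _) (levellingPair (suc x) 0 z<s r≤k)
middleLevel {suc k} (suc n) r 2≤k 2≤r _ | yes r≤k =
  prepend Fin.zero (middleLevel n r 2≤k 2≤r
    -- Two digits already leave room: `2 + r` is at most twice the largest digit.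
    (≤-trans (+-mono-≤ 2≤k r≤k) (+-monoʳ-≤ (suc k) (m≤m+n (suc k) (n * suc k)))))
-- The largest digit is now `suc k`, and `e` is the excess over one more than it: `r` is
-- `2 + k + e`.
middleLevel {suc k} n r 2≤k 2≤r hi | no r≰k with m≤n⇒∃[o]m+o≡n (≰⇒> r≰k)
middleLevel {suc k} zero r 2≤k 2≤r hi | no _ | e , refl =
  subst (Inequivalent _ 2) (+-suc (suc k) e)
    (levellingPair k (suc e) (s≤s⁻¹ (+-cancelˡ-≤ (suc k) _ _ bound)) ≤-refl)
  where
  bound : suc k + (3 + e) ≤ suc k + suc k
  bound = subst₂ _≤_ (solve 2 (λ k e → con 2 :+ (con 2 :+ k :+ e) := con 1 :+ k :+ (con 3 :+ e)) refl k e)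
                     (cong (suc k +_) (+-identityʳ (suc k))) hi
    where open +-*-Solver
-- Here r is the largest digit plus one: prepending the largest digit would leave sum 1, and
-- prepending 0 a sum that is too big when n = 0 and the largest digit is 2.
middleLevel {suc k} (suc n) r 2≤k 2≤r hi | no _ | zero , refl =
  subst (Inequivalent _ (3 + n)) (sym (+-identityʳ (2 + k)))
    (prepend (Fin.suc Fin.zero) (middleLevel n (suc k) 2≤k 2≤k
      (+-mono-≤ 2≤k (m≤m+n (suc k) (n * suc k)))))
middleLevel {suc k} (suc n) r 2≤k 2≤r hi | no _ | suc e , refl =
  subst (Inequivalent _ (3 + n))
    (trans (cong (_+ (2 + e)) (Fin.toℕ-fromℕ (suc k))) (+-suc (suc k) (suc e)))
    (prepend (Fin.fromℕ (suc k)) (middleLevel n (2 + e) 2≤k (s≤s (s≤s z≤n))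
      (+-cancelˡ-≤ (suc k) _ _ bound)))
  where
  bound : suc k + (4 + e) ≤ suc k + (2 + n) * suc k
  bound = subst (_≤ (3 + n) * suc k)
    (solve 2 (λ k e → con 2 :+ (con 2 :+ k :+ (con 1 :+ e)) := con 1 :+ k :+ (con 4 :+ e)) refl k e) hi
    where open +-*-Solver

-- Extreme and middle sums, and the conclusion.

extremeOrMiddle : ∀ M r → r ≤ M → (r ≡ 0 ⊎ r ≡ 1 ⊎ r ≡ M ∸ 1 ⊎ r ≡ M) ⊎ (2 ≤ r × 2 + r ≤ M)
extremeOrMiddle M zero       _   = inj₁ (inj₁ refl)
extremeOrMiddle M (suc zero) _   = inj₁ (inj₂ (inj₁ refl))
extremeOrMiddle M r@(suc (suc _)) r≤M with m≤n⇒m<n∨m≡n r≤M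
... | inj₂ r≡M = inj₁ (inj₂ (inj₂ (inj₂ r≡M)))
... | inj₁ r<M with m≤n⇒m<n∨m≡n r<M
...   | inj₂ 1+r≡M = inj₁ (inj₂ (inj₂ (inj₁ (cong pred 1+r≡M))))
...   | inj₁ 2+r≤M = inj₂ (s≤s (s≤s z≤n) , 2+r≤M)

middle-notEulerian : ∀ n r → 2 ≤ k → 2 ≤ r → 2 + r ≤ (2 + n) * k → ¬ Eulerian (S (suc k) r r (suc n))
middle-notEulerian {k} n r 2≤k 2≤r hi (strong , _)
  with inequivalent a b a≡r b≡r a≁b ← middleLevel n r 2≤k 2≤r hi =
  a≁b (walk⇒↭ (suc k) r (suc n) (strong (source a) (source b) (a , ea , inj₁ refl) (b , eb , inj₁ refl))
         a b ea eb refl refl)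
  where
  ea = ≤-reflexive (sym a≡r) , ≤-reflexive a≡r
  eb = ≤-reflexive (sym b≡r) , ≤-reflexive b≡r

theorem4p5 : (n k : ℕ) → n ≥ 2 → k > 2 →
    ((r : ℕ) → r ≤ (k ∸ 1) * n →
    Eulerian (S k r r (n ∸ 1)) ⇔
    (r ≡ 0 ⊎ r ≡ 1 ⊎ r ≡ (k ∸ 1) * n ∸ 1 ⊎ r ≡ (k ∸ 1) * n))
    × ((r : ℕ) → r < (k ∸ 1) * n → Eulerian (S k r (r + 1) (n ∸ 1)))
theorem4p5 (suc (suc n)) (suc (suc (suc k))) (s≤s (s≤s _)) (s≤s (s≤s (s≤s _))) =
    (λ r r≤M → mk⇔ (extreme r r≤M) (eulerian r))
  , λ r _ → subst (λ s → Eulerian (S (3 + k) r s (suc n))) (+-comm 1 r)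
              (twoLevels-eulerian (3 + k) r (suc n))
  where
  M : ℕ
  M = (2 + k) * (2 + n)

  extreme : ∀ r → r ≤ M → Eulerian (S (3 + k) r r (suc n)) → r ≡ 0 ⊎ r ≡ 1 ⊎ r ≡ M ∸ 1 ⊎ r ≡ M
  extreme r r≤M eul with extremeOrMiddle M r r≤M
  ... | inj₁ ext = ext
  ... | inj₂ (2≤r , 2+r≤M) = contradiction eul
    -- From `k > 2` the largest digit is at least 2.
    (middle-notEulerian n r (s≤s (s≤s z≤n)) 2≤r
      (subst (2 + r ≤_) (*-comm (2 + k) (2 + n)) 2+r≤M))

  eulerian : ∀ r → r ≡ 0 ⊎ r ≡ 1 ⊎ r ≡ M ∸ 1 ⊎ r ≡ M → Eulerian (S (3 + k) r r (suc n))
  eulerian r ext = edgesConnected⇒eulerian (3 + k) r r (suc n) (connected ext)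
    where
    connected : r ≡ 0 ⊎ r ≡ 1 ⊎ r ≡ M ∸ 1 ⊎ r ≡ M → EdgesConnected (3 + k) r r (suc n)
    connected (inj₁ refl)               = level₀-connected (3 + k) (suc n)
    connected (inj₂ (inj₁ refl))        = level₁-connected (1 + k) (suc n)
    connected (inj₂ (inj₂ (inj₁ refl))) =
      -- `M` computes to a successor, so `1 + (M ∸ 1)` is `M` by computation and commutativity
      -- suffices.
      complement-connected (*-comm (2 + k) (2 + n)) (level₁-connected (1 + k) (suc n))
    connected (inj₂ (inj₂ (inj₂ refl))) =
      complement-connected (*-comm (2 + k) (2 + n)) (level₀-connected (3 + k) (suc n))
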